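{- Let $H$ be a skew Hadamard matrix of order $4u$. Then there exists a directed Deza graph with parameters $(8u,4u-1,4u-1,2u-1,0)$.
   Context: A Hadamard matrix of order $n$ is an $n\times n$ $(1,-1)$-matrix $H$ with $HH^t=nI_n$; it is skew (skew-type) if $H+H^t=2I_n$. Digraphs have no loops and at most one arc from one vertex to another. Write $u\rightarrow v$ if there is an arc from $u$ to $v$. Two vertices $u,v$ are called adjacent if $u\rightarrow v$ and $v\rightarrow u$. Let $n,k,b,a,t$ be integers with $0\le a\le b\le k\le n$ and $0\le t\le k$. A digraph $D=(V,A)$ is a directed Deza graph with parameters $(n,k,b,a,t)$ if: (1) $|V|=n$; (2) every vertex has in-degree and out-degree $k$ and is adjacent to exactly $t$ vertices; (3) for any distinct vertices $u,v$, the number of vertices $w$ with $u\rightarrow w\rightarrow v$ is $a$ or $b$. -}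

module Defs where

open import Algebra.Properties.Monoid.Sum using (sum)
open import Data.Bool.Base using (if_then_else_)
open import Data.Fin.Base using (Fin)
open import Data.Fin.Properties using (_≟_)
open import Data.Integer.Base as ℤ using (ℤ; +_; 0ℤ; 1ℤ; -1ℤ)
open import Data.Integer.Properties using (+-0-monoid)
open import Data.Nat.Base using (ℕ; _≤_)
open import Data.Product.Base using (_×_)
open import Data.Sum.Base using (_⊎_)
open import Data.Vec.Base using (count; allFin)
open import Data.Vec.Functional using (Vector; transpose)
open import Level using (0ℓ)
open import Relation.Binary.Core using (Rel)
import Relation.Binary.Definitions as B
open import Relation.Binary.PropositionalEquality.Core using (_≡_; _≢_)
open import Relation.Nullary.Decidable using (does; _×-dec_)
open import Relation.Nullary.Negation using (¬_)
open import Relation.Unary using (Pred; Decidable)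

Matrix : ℕ → Set
Matrix n = Vector (Vector ℤ n) n

infix  4 _≋_
infixl 6 _⊕_
infixl 7 _⊗_ _·_

_≋_ : ∀ {n} → Matrix n → Matrix n → Set
A ≋ B = ∀ i j → A i j ≡ B i j

_⊕_ : ∀ {n} → Matrix n → Matrix n → Matrix n
(A ⊕ B) i j = A i j ℤ.+ B i j

_⊗_ : ∀ {n} → Matrix n → Matrix n → Matrix n
(A ⊗ B) i j = sum +-0-monoid (λ k → A i k ℤ.* B k j)

_·_ : ∀ {n} → ℤ → Matrix n → Matrix n
(c · A) i j = c ℤ.* A i j

I : ∀ n → Matrix n
I n i j = if does (i ≟ j) then 1ℤ else 0ℤ

record IsHadamard {n : ℕ} (H : Matrix n) : Set where
  field
    ±1-entries : ∀ i j → H i j ≡ 1ℤ ⊎ H i j ≡ -1ℤ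
    orthogonal : H ⊗ transpose H ≋ + n · I n

record IsSkewHadamard {n : ℕ} (H : Matrix n) : Set where
  field
    isHadamard : IsHadamard H
    skew       : H ⊕ transpose H ≋ + 2 · I n

-- Arcs form a relation, so there is at most one arc from one vertex to another,
-- while opposite arcs are allowed; decidability is what makes counting possible.
record Digraph (n : ℕ) : Set₁ where
  infix 4 _⟶_ _⟶?_
  field
    _⟶_     : Rel (Fin n) 0ℓ
    _⟶?_    : B.Decidable _⟶_
    no-loops : ∀ v → ¬ (v ⟶ v)

#[_] : ∀ {n} {P : Pred (Fin n) 0ℓ} → Decidable P → ℕ
#[_] {n} P? = count P? (allFin n)

module _ {n : ℕ} (D : Digraph n) where
  open Digraph D

  outDegree inDegree : Fin n → ℕ
  outDegree v = #[ (λ w → v ⟶? w) ]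
  inDegree  v = #[ (λ w → w ⟶? v) ]

  Adjacent : Rel (Fin n) 0ℓ
  Adjacent v w = (v ⟶ w) × (w ⟶ v)

  adjacent? : B.Decidable Adjacent
  adjacent? v w = (v ⟶? w) ×-dec (w ⟶? v)

  adjacentCount : Fin n → ℕ
  adjacentCount v = #[ adjacent? v ]

  twoPaths : Fin n → Fin n → ℕ
  twoPaths u v = #[ (λ w → (u ⟶? w) ×-dec (w ⟶? v)) ]

record DirectedDezaGraph (n k b a t : ℕ) : Set₁ where
  field
    a≤b : a ≤ b
    b≤k : b ≤ k
    k≤n : k ≤ n
    t≤k : t ≤ k

    digraph : Digraph n

    out-regular : ∀ v → outDegree digraph v ≡ k
    in-regular  : ∀ v → inDegree digraph v ≡ k
    adjacencies : ∀ v → adjacentCount digraph v ≡ t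
    paths       : ∀ u v → u ≢ v →
                  twoPaths digraph u v ≡ a ⊎ twoPaths digraph u v ≡ b

{-# OPTIONS --safe #-}

-- Write H = I + S, so that S is skew with zero diagonal, entries ±1 elsewhere and
-- S² = −(n − 1)I.  The digraph is the signed double cover of S: its vertices are the
-- pairs (i , σ) with σ = ±1, and (i , σ) → (j , τ) when S i j = σ τ.  The indicator of
-- this arc is (S i j ² + σ τ S i j) / 2; multiplying two of them and summing out the
-- middle vertex expresses the number of 2-paths through S² and the entries of S ∘ S.
module Submission where

open import Defs
open import Data.Bool.Base using (Bool; true; false; if_then_else_; _∧_)
open import Data.Fin.Base using (Fin; zero; suc; _↑ˡ_; _↑ʳ_; splitAt)
import Data.Fin.Properties as Fin
open import Data.Integer.Base using (ℤ; +_; 0ℤ; 1ℤ; -1ℤ)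
open import Data.Integer.Properties as ℤₚ using (+-*-semiring)
open import Data.Integer.Tactic.RingSolver using (solve-∀)
open import Data.Nat.Base as ℕ using (ℕ; NonZero)
import Data.Nat.Properties as ℕₚ
import Data.Nat.Tactic.RingSolver as ℕ-Ring
open import Data.Product.Base using (_,_)
open import Data.Sum.Base using (_⊎_; inj₁; inj₂; [_,_]′; reduce)
open import Data.Vec.Base using (count; tabulate)
open import Data.Vec.Functional using (Vector)
open import Function.Base using (_∘_; id; const; case_of_)
open import Level using (0ℓ)
open import Relation.Binary.PropositionalEquality
open import Relation.Nullary.Decidable using (yes; no; does; _×-dec_; dec-true; dec-false)
open import Relation.Nullary.Negation using (¬_; contradiction)
open import Relation.Unary using (Pred; Decidable)

open import Algebra.Properties.Semiring.Sum +-*-semiring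
  using (sum; sum-cong-≗; ∑-distrib-+; *-distribˡ-sum; sum-replicate-zero)

open ≡-Reasoning

-- Counting as summation of integer indicators.

𝟙 : Bool → ℤ
𝟙 b = if b then 1ℤ else 0ℤ

module _ where
  open import Data.Integer.Base using (_+_; _*_; _-_; -_)

  𝟙-∧ : ∀ a b → 𝟙 (a ∧ b) ≡ 𝟙 a * 𝟙 b
  𝟙-∧ false b     = refl
  𝟙-∧ true  false = refl
  𝟙-∧ true  true  = refl

  -- `allFin` is `tabulate id`; an arbitrary `f` in place of `id` lets the induction pass to the
  -- tail, where `f` becomes `f ∘ suc`.
  count≡sum : ∀ {n k} {P : Pred (Fin k) 0ℓ} (P? : Decidable P) (f : Vector (Fin k) n) →
              + count P? (tabulate f) ≡ sum (λ i → 𝟙 (does (P? (f i))))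
  count≡sum {ℕ.zero}  P? f = refl
  count≡sum {ℕ.suc n} P? f with does (P? (f zero))
  ... | true  = cong (λ x → 1ℤ + x) (count≡sum P? (f ∘ suc))
  ... | false = trans (count≡sum P? (f ∘ suc)) (sym (ℤₚ.+-identityˡ _))

  count-none : ∀ {n} {P : Pred (Fin n) 0ℓ} (P? : Decidable P) → (∀ i → ¬ P i) → #[ P? ] ≡ 0
  count-none {n} P? none = ℤₚ.+-injective (begin
    + #[ P? ]                        ≡⟨ count≡sum P? id ⟩
    sum (λ i → 𝟙 (does (P? i)))      ≡⟨ sum-cong-≗ (λ i → cong 𝟙 (dec-false (P? i) (none i))) ⟩
    sum {n} (const 0ℤ)               ≡⟨ sum-replicate-zero n ⟩
    0ℤ                               ∎)

  ∑-distrib-- : ∀ {n} (f g : Vector ℤ n) → sum (λ i → f i - g i) ≡ sum f - sum g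
  ∑-distrib-- {ℕ.zero}  f g = refl
  ∑-distrib-- {ℕ.suc n} f g =
    trans (cong (λ x → f zero - g zero + x) (∑-distrib-- (f ∘ suc) (g ∘ suc)))
          (interchange (f zero) (g zero) (sum (f ∘ suc)) (sum (g ∘ suc)))
    where
    interchange : ∀ a b c d → (a - b) + (c - d) ≡ (a + c) - (b + d)
    interchange = solve-∀

  sum-ones : ∀ n → sum {n} (const 1ℤ) ≡ + n
  sum-ones ℕ.zero    = refl
  sum-ones (ℕ.suc n) = cong (λ x → 1ℤ + x) (sum-ones n)

  sum-++ : ∀ m {n} (f : Vector ℤ (m ℕ.+ n)) →
           sum f ≡ sum (λ i → f (i ↑ˡ n)) + sum (λ j → f (m ↑ʳ j))
  sum-++ ℕ.zero    f = sym (ℤₚ.+-identityˡ _)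
  sum-++ (ℕ.suc m) f =
    trans (cong (λ x → f zero + x) (sum-++ m (f ∘ suc))) (sym (ℤₚ.+-assoc (f zero) _ _))

  -- Entries and row sums of the identity matrix.

  I-diag : ∀ {n} (i : Fin n) → I n i i ≡ 1ℤ
  I-diag i = cong 𝟙 (dec-true (i Fin.≟ i) refl)

  I-off : ∀ {n} {i j : Fin n} → i ≢ j → I n i j ≡ 0ℤ
  I-off {i = i} {j} i≢j = cong 𝟙 (dec-false (i Fin.≟ j) i≢j)

  I-sym : ∀ {n} (i j : Fin n) → I n i j ≡ I n j i
  I-sym i j with i Fin.≟ j
  ... | yes refl = sym (I-diag i)
  ... | no  i≢j  = sym (I-off (i≢j ∘ sym))

  sum-I-* : ∀ {n} (i : Fin n) (f : Vector ℤ n) → sum (λ k → I n i k * f k) ≡ f i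
  sum-I-* {ℕ.suc n} zero f = begin
    1ℤ * f zero + sum {n} (const 0ℤ) ≡⟨ cong₂ _+_ (ℤₚ.*-identityˡ (f zero)) (sum-replicate-zero n) ⟩
    f zero + 0ℤ                      ≡⟨ ℤₚ.+-identityʳ (f zero) ⟩
    f zero                           ∎
  sum-I-* {ℕ.suc n} (suc i) f = trans (ℤₚ.+-identityˡ _) (sum-I-* i (f ∘ suc))

  sum-I : ∀ {n} (i : Fin n) → sum (I n i) ≡ 1ℤ
  sum-I {n} i = trans (sum-cong-≗ (λ k → sym (ℤₚ.*-identityʳ (I n i k)))) (sum-I-* i (const 1ℤ))

  sum-Iʳ : ∀ {n} (j : Fin n) → sum (λ k → I n k j) ≡ 1ℤ
  sum-Iʳ j = trans (sum-cong-≗ (λ k → I-sym k j)) (sum-I j)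

  -- Arithmetic of signs.

  ±1 : ℤ → Set
  ±1 x = x ≡ 1ℤ ⊎ x ≡ -1ℤ

  ±1-* : ∀ {x y} → ±1 x → ±1 y → ±1 (x * y)
  ±1-* (inj₁ refl) (inj₁ refl) = inj₁ refl
  ±1-* (inj₁ refl) (inj₂ refl) = inj₂ refl
  ±1-* (inj₂ refl) (inj₁ refl) = inj₂ refl
  ±1-* (inj₂ refl) (inj₂ refl) = inj₁ refl

  ±1-sq : ∀ {x} → ±1 x → x * x ≡ 1ℤ
  ±1-sq (inj₁ refl) = refl
  ±1-sq (inj₂ refl) = refl

  -- For x = ±1 the right side is 1 + sx, which is 2 if x = s and 0 if x = -s; for x = 0 both sides
  -- vanish, since a sign is never 0. Doubling keeps the polynomial form of the indicator integral.
  𝟙-sign : ∀ {x s} → x ≡ 0ℤ ⊎ ±1 x → ±1 s → + 2 * 𝟙 (does (x ℤₚ.≟ s)) ≡ x * x + s * x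
  𝟙-sign (inj₁ refl)        (inj₁ refl) = refl
  𝟙-sign (inj₁ refl)        (inj₂ refl) = refl
  𝟙-sign (inj₂ (inj₁ refl)) (inj₁ refl) = refl
  𝟙-sign (inj₂ (inj₁ refl)) (inj₂ refl) = refl
  𝟙-sign (inj₂ (inj₂ refl)) (inj₁ refl) = refl
  𝟙-sign (inj₂ (inj₂ refl)) (inj₂ refl) = refl

  -- The skew part of a skew Hadamard matrix.

  module SkewPart {n} (H : Matrix n) (isSkew : IsSkewHadamard H) where
    open IsSkewHadamard isSkew
    open IsHadamard isHadamard

    -- `E` is J - I, with J the all-ones matrix; it is also the entrywise square of `S`.
    S E : Matrix n
    S i j = H i j - I n i j
    E i j = 1ℤ - I n i j

    -- On the diagonal, skewness reads 2h = 2 for the entry h, which rules out h = -1.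
    H-diag : ∀ i → H i i ≡ 1ℤ
    H-diag i with ±1-entries i i | trans (skew i i) (cong (+ 2 *_) (I-diag i))
    ... | inj₁ Hᵢᵢ≡1  | _ = Hᵢᵢ≡1
    ... | inj₂ Hᵢᵢ≡-1 | 2Hᵢᵢ≡2 rewrite Hᵢᵢ≡-1 = contradiction 2Hᵢᵢ≡2 λ ()

    S-diag : ∀ i → S i i ≡ 0ℤ
    S-diag i = cong₂ _-_ (H-diag i) (I-diag i)

    S-off : ∀ {i j} → i ≢ j → ±1 (S i j)
    S-off {i} {j} i≢j = subst ±1 (sym S≡H) (±1-entries i j)
      where
      S≡H : S i j ≡ H i j
      S≡H = trans (cong (λ d → H i j - d) (I-off i≢j)) (ℤₚ.+-identityʳ (H i j))

    S-values : ∀ i j → S i j ≡ 0ℤ ⊎ ±1 (S i j)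
    S-values i j = case i Fin.≟ j of λ where
      (yes refl) → inj₁ (S-diag i)
      (no  i≢j)  → inj₂ (S-off i≢j)

    S-sq : ∀ i j → S i j * S i j ≡ E i j
    S-sq i j = case i Fin.≟ j of λ where
      (yes refl) → trans (cong₂ _*_ (S-diag i) (S-diag i)) (sym (cong (λ d → 1ℤ - d) (I-diag i)))
      (no  i≢j)  → trans (±1-sq (S-off i≢j)) (sym (cong (λ d → 1ℤ - d) (I-off i≢j)))

    S-skew : ∀ i j → S j i ≡ - S i j
    S-skew i j = begin
      H j i - I n j i                             ≡⟨ cong (λ d → H j i - d) (I-sym j i) ⟩
      H j i - I n i j                             ≡⟨ regroup (H i j) (H j i) (I n i j) ⟩
      (H i j + H j i) - (H i j + I n i j)         ≡⟨ cong (_- (H i j + I n i j)) (skew i j) ⟩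
      + 2 * I n i j - (H i j + I n i j)           ≡⟨ collect (H i j) (I n i j) ⟩
      - S i j                                     ∎
      where
      regroup : ∀ h h′ d → h′ - d ≡ (h + h′) - (h + d)
      regroup = solve-∀

      collect : ∀ h d → + 2 * d - (h + d) ≡ - (h - d)
      collect = solve-∀

    -- By skewness S² = -SSᵗ, and SSᵗ = (H - I)(Hᵗ - I) = HHᵗ - (H + Hᵗ) + I = nI - 2I + I.
    S-square : ∀ i j → sum (λ k → S i k * S k j) ≡ - (+ n - 1ℤ) * I n i j
    S-square i j = begin
      sum (λ k → S i k * S k j)
        ≡⟨ sum-cong-≗ (λ k → trans (cong (S i k *_) (S-skew j k))
             (expand (H i k) (I n i k) (H j k) (I n j k))) ⟩
      sum (λ k → (I n i k * H j k + I n j k * H i k) - (H i k * H j k + I n i k * I n j k))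
        ≡⟨ ∑-distrib-- (λ k → I n i k * H j k + I n j k * H i k) _ ⟩
      sum (λ k → I n i k * H j k + I n j k * H i k) - sum (λ k → H i k * H j k + I n i k * I n j k)
        ≡⟨ cong₂ _-_ (∑-distrib-+ (λ k → I n i k * H j k) _) (∑-distrib-+ (λ k → H i k * H j k) _) ⟩
      (sum (λ k → I n i k * H j k) + sum (λ k → I n j k * H i k))
        - (sum (λ k → H i k * H j k) + sum (λ k → I n i k * I n j k))
        ≡⟨ cong₂ _-_ (cong₂ _+_ (sum-I-* i (H j)) (sum-I-* j (H i)))
             (cong₂ _+_ (orthogonal i j) (trans (sum-I-* i (I n j)) (I-sym j i))) ⟩
      (H j i + H i j) - (+ n * I n i j + I n i j)
        ≡⟨ cong (_- (+ n * I n i j + I n i j)) (trans (ℤₚ.+-comm (H j i) (H i j)) (skew i j)) ⟩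
      + 2 * I n i j - (+ n * I n i j + I n i j)
        ≡⟨ collect (+ n) (I n i j) ⟩
      - (+ n - 1ℤ) * I n i j ∎
      where
      expand : ∀ h d h′ d′ → (h - d) * - (h′ - d′) ≡ (d * h′ + d′ * h) - (h * h′ + d * d′)
      expand = solve-∀

      collect : ∀ N d → + 2 * d - (N * d + d) ≡ - (N - 1ℤ) * d
      collect = solve-∀

    sum-Eˡ : ∀ i → sum (E i) ≡ + n - 1ℤ
    sum-Eˡ i = trans (∑-distrib-- (const 1ℤ) (I n i)) (cong₂ _-_ (sum-ones n) (sum-I i))

    sum-Eʳ : ∀ j → sum (λ k → E k j) ≡ + n - 1ℤ
    sum-Eʳ j = trans (∑-distrib-- (const 1ℤ) (λ k → I n k j)) (cong₂ _-_ (sum-ones n) (sum-Iʳ j))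

    -- This is (J - I)² = J² - 2J + I = (n - 2)J + I, read entrywise.
    E-square : ∀ i j → sum (λ k → E i k * E k j) ≡ (+ n - + 2) + I n i j
    E-square i j = begin
      sum (λ k → E i k * E k j)
        ≡⟨ sum-cong-≗ (λ k → expand (I n i k) (I n k j)) ⟩
      sum (λ k → (E i k + I n i k * I n k j) - I n k j)
        ≡⟨ ∑-distrib-- (λ k → E i k + I n i k * I n k j) _ ⟩
      sum (λ k → E i k + I n i k * I n k j) - sum (λ k → I n k j)
        ≡⟨ cong₂ _-_ (∑-distrib-+ (E i) _) (sum-Iʳ j) ⟩
      (sum (E i) + sum (λ k → I n i k * I n k j)) - 1ℤ
        ≡⟨ cong (_- 1ℤ) (cong₂ _+_ (sum-Eˡ i) (sum-I-* i (λ k → I n k j))) ⟩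
      ((+ n - 1ℤ) + I n i j) - 1ℤ
        ≡⟨ collect (+ n) (I n i j) ⟩
      (+ n - + 2) + I n i j ∎
      where
      expand : ∀ d d′ → (1ℤ - d) * (1ℤ - d′) ≡ ((1ℤ - d) + d * d′) - d′
      expand = solve-∀

      collect : ∀ N d → ((N - 1ℤ) + d) - 1ℤ ≡ (N - + 2) + d
      collect = solve-∀

    -- The signed double cover, whose two sheets are the halves of `Fin (n + n)`.

    base : Fin (n ℕ.+ n) → Fin n
    base v = reduce (splitAt n v)

    σ : Fin (n ℕ.+ n) → ℤ
    σ v = [ const 1ℤ , const -1ℤ ]′ (splitAt n v)

    σ-±1 : ∀ v → ±1 (σ v)
    σ-±1 v with splitAt n v
    ... | inj₁ _ = inj₁ refl
    ... | inj₂ _ = inj₂ refl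

    -- Each fibre of `base` has one vertex per sheet. Two vertices on the same sheet with equal
    -- bases would coincide, as inverting `splitAt` shows; so the sheets differ and the signs are
    -- opposite.
    antipodal : ∀ {v w} → v ≢ w → base v ≡ base w → σ v * σ w ≡ -1ℤ
    antipodal {v} {w} v≢w with splitAt n v in eqᵛ | splitAt n w in eqʷ
    ... | inj₁ i | inj₁ j = λ { refl → contradiction
            (trans (sym (Fin.splitAt⁻¹-↑ˡ eqᵛ)) (Fin.splitAt⁻¹-↑ˡ eqʷ)) v≢w }
    ... | inj₁ i | inj₂ j = λ _ → refl
    ... | inj₂ i | inj₁ j = λ _ → refl
    ... | inj₂ i | inj₂ j = λ { refl → contradiction
            (trans (sym (Fin.splitAt⁻¹-↑ʳ {i = v} eqᵛ)) (Fin.splitAt⁻¹-↑ʳ {i = w} eqʷ)) v≢w }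

    -- Grouping the two lifts of each base vertex makes every term that is odd in the sign cancel;
    -- all the counts below rely on this.
    sum-cover : (f : Fin n → ℤ → ℤ) →
                sum (λ v → f (base v) (σ v)) ≡ sum (λ k → f k 1ℤ + f k -1ℤ)
    sum-cover f = begin
      sum (λ v → f (base v) (σ v))
        ≡⟨ sum-++ n (λ v → f (base v) (σ v)) ⟩
      sum (λ k → f (base (k ↑ˡ n)) (σ (k ↑ˡ n))) + sum (λ k → f (base (n ↑ʳ k)) (σ (n ↑ʳ k)))
        ≡⟨ cong₂ _+_
             (sum-cong-≗ (λ k → cong g (Fin.splitAt-↑ˡ n k n)))
             (sum-cong-≗ (λ k → cong g (Fin.splitAt-↑ʳ n n k))) ⟩
      sum (λ k → f k 1ℤ) + sum (λ k → f k -1ℤ)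
        ≡⟨ ∑-distrib-+ (λ k → f k 1ℤ) (λ k → f k -1ℤ) ⟨
      sum (λ k → f k 1ℤ + f k -1ℤ) ∎
      where
      -- Base and sign both factor through `splitAt`, so one congruence evaluates them together.
      g : Fin n ⊎ Fin n → ℤ
      g x = f (reduce x) ([ const 1ℤ , const -1ℤ ]′ x)

    cover : Digraph (n ℕ.+ n)
    cover = record
      { _⟶_      = λ v w → S (base v) (base w) ≡ σ v * σ w
      ; _⟶?_     = λ v w → S (base v) (base w) ℤₚ.≟ σ v * σ w
      -- A loop would equate the diagonal entry 0 of `S` with the square of a sign, which is 1.
      ; no-loops = λ v arc → contradiction
          (trans (sym (S-diag (base v))) (trans arc (±1-sq (σ-±1 v)))) λ ()
      }

    open Digraph cover

    arc : Fin (n ℕ.+ n) → Fin (n ℕ.+ n) → ℤ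
    arc v w = 𝟙 (does (v ⟶? w))

    2*arc : ∀ v w → + 2 * arc v w ≡
            E (base v) (base w) + σ v * σ w * S (base v) (base w)
    2*arc v w = trans (𝟙-sign (S-values (base v) (base w)) (±1-* (σ-±1 v) (σ-±1 w)))
                      (cong (_+ σ v * σ w * S (base v) (base w)) (S-sq (base v) (base w)))

    -- Degrees, and the absence of opposite arcs.

    outDegree≡n-1 : ∀ v → + outDegree cover v ≡ + n - 1ℤ
    outDegree≡n-1 v = ℤₚ.*-cancelˡ-≡ (+ 2) _ _ (begin
      + 2 * + outDegree cover v                ≡⟨ cong (+ 2 *_) (count≡sum (v ⟶?_) id) ⟩
      + 2 * sum (arc v)                        ≡⟨ *-distribˡ-sum (+ 2) (arc v) ⟩
      sum (λ w → + 2 * arc v w)                ≡⟨ sum-cong-≗ (2*arc v) ⟩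
      sum (λ w → E i (base w) + s * σ w * S i (base w))
        ≡⟨ sum-cover (λ k t → E i k + s * t * S i k) ⟩
      sum (λ k → (E i k + s * 1ℤ * S i k) + (E i k + s * -1ℤ * S i k))
        -- The two lifts of `k` have opposite signs, so the `S` terms cancel: exactly one lift of
        -- each `k` other than `i` is an out-neighbour.
        ≡⟨ sum-cong-≗ (λ k → cancel (E i k) s (S i k)) ⟩
      sum (λ k → + 2 * E i k)                  ≡⟨ *-distribˡ-sum (+ 2) (E i) ⟨
      + 2 * sum (E i)                          ≡⟨ cong (+ 2 *_) (sum-Eˡ i) ⟩
      + 2 * (+ n - 1ℤ)                         ∎)
      where
      i = base v
      s = σ v

      cancel : ∀ e s x → (e + s * 1ℤ * x) + (e + s * -1ℤ * x) ≡ + 2 * e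
      cancel = solve-∀

    inDegree≡n-1 : ∀ v → + inDegree cover v ≡ + n - 1ℤ
    inDegree≡n-1 v = ℤₚ.*-cancelˡ-≡ (+ 2) _ _ (begin
      + 2 * + inDegree cover v                 ≡⟨ cong (+ 2 *_) (count≡sum (_⟶? v) id) ⟩
      + 2 * sum (λ w → arc w v)                ≡⟨ *-distribˡ-sum (+ 2) (λ w → arc w v) ⟩
      sum (λ w → + 2 * arc w v)                ≡⟨ sum-cong-≗ (λ w → 2*arc w v) ⟩
      sum (λ w → E (base w) j + σ w * t * S (base w) j)
        ≡⟨ sum-cover (λ k s → E k j + s * t * S k j) ⟩
      sum (λ k → (E k j + 1ℤ * t * S k j) + (E k j + -1ℤ * t * S k j))
        ≡⟨ sum-cong-≗ (λ k → cancel (E k j) t (S k j)) ⟩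
      sum (λ k → + 2 * E k j)                  ≡⟨ *-distribˡ-sum (+ 2) (λ k → E k j) ⟨
      + 2 * sum (λ k → E k j)                  ≡⟨ cong (+ 2 *_) (sum-Eʳ j) ⟩
      + 2 * (+ n - 1ℤ)                         ∎)
      where
      j = base v
      t = σ v

      cancel : ∀ e t x → (e + 1ℤ * t * x) + (e + -1ℤ * t * x) ≡ + 2 * e
      cancel = solve-∀

    -- Opposite arcs share the product of signs but carry negated entries of `S`, so that sign would
    -- equal its own negative.
    not-adjacent : ∀ v w → ¬ Adjacent cover v w
    not-adjacent v w (v⟶w , w⟶v) = ±1≢neg (±1-* (σ-±1 v) (σ-±1 w)) (begin
      σ v * σ w               ≡⟨ ℤₚ.*-comm (σ v) (σ w) ⟩
      σ w * σ v               ≡⟨ w⟶v ⟨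
      S (base w) (base v)     ≡⟨ S-skew (base v) (base w) ⟩
      - S (base v) (base w)   ≡⟨ cong -_ v⟶w ⟩
      - (σ v * σ w)           ∎)
      where
      ±1≢neg : ∀ {x} → ±1 x → x ≢ - x
      ±1≢neg (inj₁ refl) ()
      ±1≢neg (inj₂ refl) ()

    -- The number of 2-paths.

    2*twoPaths : ∀ v w → + 2 * + twoPaths cover v w ≡
                 ((+ n - + 2) + I n (base v) (base w))
                   + σ v * σ w * (- (+ n - 1ℤ) * I n (base v) (base w))
    -- Each of the two arcs of a path needs its own doubling, hence a factor 4; the two lifts of the
    -- middle vertex give back a 2, which is cancelled.
    2*twoPaths v w = ℤₚ.*-cancelˡ-≡ (+ 2) _ _ (begin
      + 2 * (+ 2 * + twoPaths cover v w)
        ≡⟨ cong (λ x → + 2 * (+ 2 * x)) (count≡sum (λ x → (v ⟶? x) ×-dec (x ⟶? w)) id) ⟩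
      + 2 * (+ 2 * sum (λ x → 𝟙 (does (v ⟶? x) ∧ does (x ⟶? w))))
        ≡⟨ ℤₚ.*-assoc (+ 2) (+ 2) _ ⟨
      + 4 * sum (λ x → 𝟙 (does (v ⟶? x) ∧ does (x ⟶? w)))
        ≡⟨ *-distribˡ-sum (+ 4) (λ x → 𝟙 (does (v ⟶? x) ∧ does (x ⟶? w))) ⟩
      sum (λ x → + 4 * 𝟙 (does (v ⟶? x) ∧ does (x ⟶? w)))
        ≡⟨ sum-cong-≗ (λ x → trans (cong (+ 4 *_) (𝟙-∧ (does (v ⟶? x)) (does (x ⟶? w))))
             (trans (split (arc v x) (arc x w)) (cong₂ _*_ (2*arc v x) (2*arc x w)))) ⟩
      sum (λ x → (E i (base x) + s * σ x * S i (base x)) * (E (base x) j + σ x * t * S (base x) j))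
        ≡⟨ sum-cover (λ k r → (E i k + s * r * S i k) * (E k j + r * t * S k j)) ⟩
      sum (λ k → (E i k + s * 1ℤ * S i k) * (E k j + 1ℤ * t * S k j)
                   + (E i k + s * -1ℤ * S i k) * (E k j + -1ℤ * t * S k j))
        -- The mixed products of `E` and `S` are linear in the middle sign and cancel; the product
        -- of two `S` entries carries its square, 1, and survives.
        ≡⟨ sum-cong-≗ (λ k → cancel s t (E i k) (E k j) (S i k) (S k j)) ⟩
      sum (λ k → + 2 * (E i k * E k j + s * t * (S i k * S k j)))
        ≡⟨ *-distribˡ-sum (+ 2) (λ k → E i k * E k j + s * t * (S i k * S k j)) ⟨
      + 2 * sum (λ k → E i k * E k j + s * t * (S i k * S k j))
        ≡⟨ cong (+ 2 *_) (∑-distrib-+ (λ k → E i k * E k j) (λ k → s * t * (S i k * S k j))) ⟩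
      + 2 * (sum (λ k → E i k * E k j) + sum (λ k → s * t * (S i k * S k j)))
        ≡⟨ cong (+ 2 *_) (cong₂ _+_ (E-square i j)
             (trans (sym (*-distribˡ-sum (s * t) (λ k → S i k * S k j)))
                    (cong (s * t *_) (S-square i j)))) ⟩
      + 2 * (((+ n - + 2) + I n i j) + s * t * (- (+ n - 1ℤ) * I n i j)) ∎)
      where
      i = base v
      j = base w
      s = σ v
      t = σ w

      split : ∀ a b → + 4 * (a * b) ≡ (+ 2 * a) * (+ 2 * b)
      split = solve-∀

      cancel : ∀ s t e e′ x x′ →
               (e + s * 1ℤ * x) * (e′ + 1ℤ * t * x′) + (e + s * -1ℤ * x) * (e′ + -1ℤ * t * x′)
               ≡ + 2 * (e * e′ + s * t * (x * x′))
      cancel = solve-∀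

    -- Both S² and the non-constant part of E² are multiples of `I`, so off the diagonal only n - 2
    -- remains, whatever the signs.
    twoPaths-off : ∀ v w → base v ≢ base w → + 2 * + twoPaths cover v w ≡ + n - + 2
    twoPaths-off v w i≢j = begin
      + 2 * + twoPaths cover v w                           ≡⟨ 2*twoPaths v w ⟩
      _
        ≡⟨ cong (λ d → ((+ n - + 2) + d) + σ v * σ w * (- (+ n - 1ℤ) * d)) (I-off i≢j) ⟩
      ((+ n - + 2) + 0ℤ) + σ v * σ w * (- (+ n - 1ℤ) * 0ℤ) ≡⟨ vanish (+ n) (σ v * σ w) ⟩
      + n - + 2                                            ∎
      where
      vanish : ∀ N c → ((N - + 2) + 0ℤ) + c * (- (N - 1ℤ) * 0ℤ) ≡ N - + 2
      vanish = solve-∀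

    -- The opposite signs turn the diagonal entry -(n - 1) of S² into n - 1, which adds to the
    -- diagonal entry n - 1 of E².
    twoPaths-antipodal : ∀ v w → v ≢ w → base v ≡ base w →
                         + twoPaths cover v w ≡ + n - 1ℤ
    twoPaths-antipodal v w v≢w i≡j = ℤₚ.*-cancelˡ-≡ (+ 2) _ _ (begin
      + 2 * + twoPaths cover v w                      ≡⟨ 2*twoPaths v w ⟩
      _
        ≡⟨ cong₂ (λ d c → ((+ n - + 2) + d) + c * (- (+ n - 1ℤ) * d)) I≡1 (antipodal v≢w i≡j) ⟩
      ((+ n - + 2) + 1ℤ) + -1ℤ * (- (+ n - 1ℤ) * 1ℤ)  ≡⟨ double (+ n) ⟩
      + 2 * (+ n - 1ℤ)                                ∎)
      where
      I≡1 : I n (base v) (base w) ≡ 1ℤ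
      I≡1 = trans (cong (I n (base v)) (sym i≡j)) (I-diag (base v))

      double : ∀ N → ((N - + 2) + 1ℤ) + -1ℤ * (- (N - 1ℤ) * 1ℤ) ≡ + 2 * (N - 1ℤ)
      double = solve-∀

  -- Writing the order as `suc p` makes n - 1 compute to `p`, the degree and the larger path count.
  -- The parity hypothesis says that (n - 2)/2 is the natural number `m`, the smaller path count.
  cover-deza : ∀ {p} (H : Matrix (ℕ.suc p)) → IsSkewHadamard H → ∀ m → p ≡ ℕ.suc (2 ℕ.* m) →
               DirectedDezaGraph (ℕ.suc p ℕ.+ ℕ.suc p) p p m 0
  cover-deza {p} H isSkew m p≡1+2m = record
    { a≤b         = subst (m ℕ.≤_) (sym p≡1+2m) (ℕₚ.m≤n⇒m≤1+n (ℕₚ.m≤m+n m _))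
    ; b≤k         = ℕₚ.≤-refl
    ; k≤n         = ℕₚ.m≤n⇒m≤1+n (ℕₚ.m≤m+n p _)
    ; t≤k         = ℕ.z≤n
    ; digraph     = cover
    ; out-regular = λ v → ℤₚ.+-injective (outDegree≡n-1 v)
    ; in-regular  = λ v → ℤₚ.+-injective (inDegree≡n-1 v)
    ; adjacencies = λ v → count-none (adjacent? cover v) (not-adjacent v)
    ; paths       = λ v w v≢w → case base v Fin.≟ base w of λ where
        (yes i≡j) → inj₂ (ℤₚ.+-injective (twoPaths-antipodal v w v≢w i≡j))
        (no  i≢j) → inj₁ (ℤₚ.+-injective (ℤₚ.*-cancelˡ-≡ (+ 2) _ _
                      (trans (twoPaths-off v w i≢j) n-2≡2m)))
    }
    where
    open SkewPart H isSkew

    n-2≡2m : + ℕ.suc p - + 2 ≡ + 2 * + m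
    n-2≡2m = trans (cong (λ q → + ℕ.suc q - + 2) p≡1+2m) (ℤₚ.pos-* 2 m)

open import Data.Nat.Base using (_*_; _∸_)

theorem3p8 : (u : ℕ) → .{{_ : NonZero u}} → (H : Matrix (4 * u)) → IsSkewHadamard H →
    DirectedDezaGraph (8 * u) (4 * u ∸ 1) (4 * u ∸ 1) (2 * u ∸ 1) 0
theorem3p8 u@(ℕ.suc u′) H isSkew =
  subst (λ N → DirectedDezaGraph N (4 * u ∸ 1) (4 * u ∸ 1) (2 * u ∸ 1) 0)
        -- The double cover has 4u + 4u vertices, to be read as 8u.
        (sym (ℕₚ.*-distribʳ-+ u 4 4))
        (cover-deza H isSkew (2 * u ∸ 1) (odd u′))
  where
  -- With u = v + 1 this is 4u - 1 = 2(2u - 1) + 1, each truncated subtraction being replaced by the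
  -- form it computes to.
  odd : ∀ v → v ℕ.+ 3 * ℕ.suc v ≡ ℕ.suc (2 * (v ℕ.+ 1 * ℕ.suc v))
  odd = ℕ-Ring.solve-∀
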